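{- For every constant $c>0$, there exists a full-compatibility instance of the online allocation model with a common nonnegative, nondecreasing, discrete-concave bonus function $f$ (i.e. $f_i=f$ for all products $i$) such that the LP-based independent-rounding policy obtained from an optimal solution of the LP relaxation satisfies $$\mathbb E[\mathrm{Rev}^{\mathrm{LP}}]<c\,\mathrm{OPT}_{\mathrm{on}}.$$
   Context: Model. An instance consists of products $\mathcal I=\{1,\dots,m\}$, capacities $b_i\in\mathbb Z_+$, base rewards $r_i\ge 0$, bonus functions $f_i:\mathbb Z_+\to\mathbb R_+$ that are nonnegative and nondecreasing with $f_i(0)=0$, a horizon of $T$ periods and arrival probabilities $p_1,\dots,p_T\in[0,1]$. In period $t$ a customer arrives with probability $p_t$, independently across periods; $L$ is the total number of arrivals and $\mu_L=\sum_{t=1}^T p_t$ its mean. Each arriving customer must be immediately and irrevocably assigned to a product with remaining capacity or rejected; every customer may be assigned to every product (full compatibility). The $k$-th sale of product $i$ yields reward $r_i+f_i(k)$. An online algorithm $\pi$ knows all parameters of the instance, but its decision in each period depends only on the arrivals observed so far, its past decisions and internal randomization independent of the arrivals. $\mathrm{Rev}^\pi$ is its random total reward and $\mathrm{OPT}_{\mathrm{on}}=\sup_\pi\mathbb E[\mathrm{Rev}^\pi]$ over all online algorithms. Discrete concavity of $f$: $f(k+1)-f(k)\le f(k)-f(k-1)$ for all $k\ge1$ in the relevant range (up to capacity). LP relaxation: maximize $\sum_{i\in\mathcal I}\sum_{k=1}^{b_i}(r_i+f_i(k))\,y_{i,k}$ subject to $\sum_{i\in\mathcal I}\sum_{k=1}^{b_i}y_{i,k}\le\mu_L$;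 $y_{i,k}\le y_{i,k-1}$ for all $i\in\mathcal I$, $k=2,\dots,b_i$; $0\le y_{i,k}\le1$ for all $i\in\mathcal I$, $k=1,\dots,b_i$. LP-based independent rounding: given an optimal solution $\boldsymbol y^*$ of this LP, set $q_i=\frac1{\mu_L}\sum_{k=1}^{b_i}y^*_{i,k}$. Each arriving customer is independently assigned to product $i$ with probability $q_i$, with any remaining probability assigned to rejection; a customer directed to a product with no remaining capacity is rejected. -}

module Defs where

open import Data.Bool.Base using (Bool; true; false; if_then_else_)
open import Data.Fin.Base using (Fin; toℕ)
open import Data.Fin.Properties using (_≟_)
open import Data.List.Base
  using (List; []; _∷_; map; foldr; length; allFin; cartesianProductWith)
open import Data.List.Relation.Unary.All using (All)
open import Data.Nat.Base as ℕ using (ℕ; zero; suc)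
import Data.Nat.Properties as ℕ
open import Data.Product.Base using (_×_; _,_; proj₁)
open import Data.Rational.Base
open import Data.Vec.Base using (Vec; []; _∷_)
open import Relation.Binary.PropositionalEquality using (_≡_)
open import Relation.Nullary.Decidable using (does)

open import Algebra.Definitions.RawMonoid +-0-rawMonoid using (sum)

-- Finitely supported distributions, as lists of weighted outcomes.  The
-- weights are constrained only by IsProbability; outcomes may be repeated.

Dist : Set → Set
Dist A = List (ℚ × A)

totalWeight : ∀ {A} → Dist A → ℚ
totalWeight = foldr (λ (w , _) acc → w + acc) 0ℚ

IsProbability : ∀ {A} → Dist A → Set
IsProbability d = All (λ wx → 0ℚ ≤ proj₁ wx) d × totalWeight d ≡ 1ℚ

𝔼 : ∀ {A} → Dist A → (A → ℚ) → ℚ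
𝔼 d X = foldr (λ (w , x) acc → w * X x + acc) 0ℚ d

bernoulli : ℚ → Dist Bool
bernoulli p = (p , true) ∷ (1ℚ - p , false) ∷ []

-- The product distribution: coordinate t is drawn from d t, independently.
independent : ∀ {A n} → (Fin n → Dist A) → Dist (Vec A n)
independent {n = zero}  d = (1ℚ , []) ∷ []
independent {n = suc n} d =
  cartesianProductWith (λ (w , x) (v , xs) → w * v , x ∷ xs)
    (d Fin.zero) (independent (λ t → d (Fin.suc t)))

record IsBonus (f : ℕ → ℚ) : Set where
  field
    nonnegative   : ∀ k → 0ℚ ≤ f k
    nondecreasing : ∀ {j k} → j ℕ.≤ k → f j ≤ f k
    at-zero       : f 0 ≡ 0ℚ

-- Concavity at the interior point suc k, for sale counts up to b.
DiscreteConcave : ℕ → (ℕ → ℚ) → Set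
DiscreteConcave b f =
  ∀ k → suc (suc k) ℕ.≤ b →
  f (suc (suc k)) - f (suc k) ≤ f (suc k) - f k

record Instance : Set where
  field
    m          : ℕ
    capacity   : Fin m → ℕ
    reward     : Fin m → ℚ
    reward≥0   : ∀ i → 0ℚ ≤ reward i
    bonus      : Fin m → ℕ → ℚ
    isBonus    : ∀ i → IsBonus (bonus i)
    T          : ℕ
    arrival    : Fin T → ℚ
    arrival≥0  : ∀ t → 0ℚ ≤ arrival t
    arrival≤1  : ∀ t → arrival t ≤ 1ℚ

module Model (I : Instance) where
  open Instance I

  meanArrivals : ℚ
  meanArrivals = sum arrival

  -- The reward of the (suc k)-th sale of product i; sales are counted from
  -- zero here, so that k is the number of earlier sales.
  saleReward : Fin m → ℕ → ℚ
  saleReward i k = reward i + bonus i (suc k)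

  data Decision : Set where
    assign : Fin m → Decision
    reject : Decision

  data Event : Set where
    noArrival : Event
    served    : Decision → Event

  -- Past periods, most recent first; its length is the number of periods
  -- already elapsed.
  History : Set
  History = List Event

  sales : Fin m → History → ℕ
  sales i []                      = 0
  sales i (noArrival         ∷ h) = sales i h
  sales i (served reject     ∷ h) = sales i h
  sales i (served (assign j) ∷ h) =
    if does (i ≟ j) then suc (sales i h) else sales i h

  -- The seed is drawn before the horizon starts, independently of the
  -- arrivals; decide is consulted only in periods in which a customer arrives.
  record Policy : Set₁ where
    field
      Seed     : Set
      seedDist : Dist Seed
      decide   : Seed → History → Decision

  record IsOnline (π : Policy) : Set where
    open Policy π
    field
      probability : IsProbability seedDist
      feasible    : ∀ s h i → decide s h ≡ assign i → sales i h ℕ.< capacity i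

  decisionReward : History → Decision → ℚ
  decisionReward h (assign i) = saleReward i (sales i h)
  decisionReward h reject     = 0ℚ

  -- Total reward from the remaining periods, given their arrivals.
  revenueFrom : ∀ {n} → (History → Decision) → History → Vec Bool n → ℚ
  revenueFrom δ h []          = 0ℚ
  revenueFrom δ h (false ∷ a) = revenueFrom δ (noArrival ∷ h) a
  revenueFrom δ h (true  ∷ a) =
    decisionReward h (δ h) + revenueFrom δ (served (δ h) ∷ h) a

  arrivals : Dist (Vec Bool T)
  arrivals = independent (λ t → bernoulli (arrival t))

  𝔼Rev : Policy → ℚ
  𝔼Rev π = 𝔼 seedDist (λ s → 𝔼 arrivals (λ a → revenueFrom (decide s) [] a))
    where open Policy π

  -- v = OPT_on, the least upper bound of the expected rewards.
  record IsOPTon (v : ℚ) : Set₁ where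
    field
      upper : ∀ π → IsOnline π → 𝔼Rev π ≤ v
      least : ∀ u → (∀ π → IsOnline π → 𝔼Rev π ≤ u) → v ≤ u

  -- LP variables; the index k : Fin (capacity i) stands for the sale number
  -- suc (toℕ k).
  LPVar : Set
  LPVar = (i : Fin m) → Fin (capacity i) → ℚ

  objective : LPVar → ℚ
  objective y = sum (λ i → sum (λ k → saleReward i (toℕ k) * y i k))

  record LPFeasible (y : LPVar) : Set where
    field
      budget   : sum (λ i → sum (y i)) ≤ meanArrivals
      monotone : ∀ i (j k : Fin (capacity i)) →
                 toℕ k ≡ suc (toℕ j) → y i k ≤ y i j
      lower    : ∀ i k → 0ℚ ≤ y i k
      upper    : ∀ i k → y i k ≤ 1ℚ

  record LPOptimal (y : LPVar) : Set where
    field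
      isFeasible : LPFeasible y
      maximal    : ∀ z → LPFeasible z → objective z ≤ objective y

  module Rounding (y : LPVar) .{{_ : NonZero meanArrivals}} where

    q : Fin m → ℚ
    q i = (1/ meanArrivals) * sum (y i)

    direction : Dist Decision
    direction = (1ℚ - sum q , reject) ∷ map (λ i → q i , assign i) (allFin m)

    directionAt : ∀ {n} → Vec Decision n → ℕ → Decision
    directionAt []       _       = reject
    directionAt (d ∷ ds) zero    = d
    directionAt (d ∷ ds) (suc t) = directionAt ds t

    follow : Decision → History → Decision
    follow reject     h = reject
    follow (assign i) h =
      if does (sales i h ℕ.<? capacity i) then assign i else reject

    -- One direction is drawn for every period, and used if a customer arrives.
    policy : Policy
    policy = record
      { Seed     = Vec Decision T
      ; seedDist = independent (λ _ → direction)
      ; decide   = λ s h → follow (directionAt s (length h)) h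
      }

{-# OPTIONS --safe #-}

-- A single customer arrives with certainty.  Product 0 pays 2k for its k-th
-- sale and has capacity n + 2; product 1 pays n + 2 for its only sale.  Serving
-- the customer with product 1 is optimal.  The LP may spread one unit of sales
-- evenly over the n + 2 sales of product 0, whose average reward is n + 3, and
-- by Chebyshev's sum inequality every optimal LP solution avoids product 1.
-- Rounding then directs the customer to product 0, at a reward of at most 2.

module Submission where

open import Defs
open import Algebra.Bundles using (CommutativeRing)
open import Data.Fin.Base as Fin using (Fin; toℕ)
open import Data.Integer.Base as ℤ using (+_)
import Data.Integer.Properties as ℤ
open import Data.List.Base using ([]; _∷_)
open import Data.List.Relation.Unary.All using (All; []; _∷_)
open import Data.Nat.Base as ℕ using (ℕ; zero; suc; z≤n; s≤s)
open import Data.Product.Base using (Σ; ∃-syntax; _×_; _,_; proj₁; proj₂)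
open import Data.Rational.Base
  using (ℚ; mkℚ; 0ℚ; 1ℚ; _<_; _≤_; _+_; _-_; -_; _*_; 1/_; toℚᵘ;
         NonZero; nonNegative; Positive; positive; +-0-rawMonoid)
open import Data.Rational.Properties
open import Data.Rational.Solver using (module +-*-Solver)
open import Data.Rational.Unnormalised.Base as ℚᵘ using (mkℚᵘ; *≡*)
import Data.Rational.Unnormalised.Properties as ℚᵘ
open import Data.Unit.Base using (⊤; tt)
open import Data.Vec.Base using ([]; _∷_)
open import Function.Base using (_∘_)
open import Relation.Binary.PropositionalEquality
  using (_≡_; refl; sym; trans; cong; cong₂; subst; module ≡-Reasoning)
open import Algebra.Definitions.RawMonoid +-0-rawMonoid
  using (sum) renaming (_×_ to _·_)
open import Algebra.Properties.CommutativeMonoid.Sum +-0-commutativeMonoid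
  using (sum-cong-≗; ∑-distrib-+)
open import Algebra.Properties.Semiring.Sum
  (CommutativeRing.semiring +-*-commutativeRing) using (*-distribˡ-sum)
open Instance using (bonus; capacity)
open Model using (meanArrivals; IsOPTon; LPOptimal; 𝔼Rev; module Rounding)
open +-*-Solver using (solve; _:+_; _:*_; _:-_; _:=_; con)

-- Natural multiples of rationals and the Archimedean property.

2ℚ : ℚ
2ℚ = 1ℚ + 1ℚ

·-nonNegative : ∀ n {x} → 0ℚ ≤ x → 0ℚ ≤ n · x
·-nonNegative zero    0≤x = ≤-refl
·-nonNegative (suc n) 0≤x = +-mono-≤ 0≤x (·-nonNegative n 0≤x)

·-monoˡ-≤ : ∀ {x m n} → 0ℚ ≤ x → m ℕ.≤ n → m · x ≤ n · x
·-monoˡ-≤ {n = n} 0≤x z≤n       = ·-nonNegative n 0≤x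
·-monoˡ-≤ {x}     0≤x (s≤s m≤n) = +-monoʳ-≤ x (·-monoˡ-≤ 0≤x m≤n)

-- Unnormalised fractions avoid the gcd reduction in rational addition, so induction can keep the
-- denominator equal to one.
toℚᵘ-·1 : ∀ n → toℚᵘ (n · 1ℚ) ℚᵘ.≃ mkℚᵘ (+ n) 0
toℚᵘ-·1 zero    = ℚᵘ.≃-refl
toℚᵘ-·1 (suc n) = ℚᵘ.≃-trans (toℚᵘ-homo-+ 1ℚ (n · 1ℚ))
  (ℚᵘ.≃-trans (ℚᵘ.+-congʳ (toℚᵘ 1ℚ) (toℚᵘ-·1 n))
    (*≡* (cong (ℤ._* + 1) (cong (ℤ._+_ (+ 1)) (ℤ.*-identityʳ (+ n))))))

-- Denominators are at least one, so the absolute value of the numerator serves as the bound.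
archimedean : ∀ p → ∃[ n ] p ≤ n · 1ℚ
archimedean p@(mkℚ k d _) = ℤ.∣ k ∣ , toℚᵘ-cancel-≤
  (ℚᵘ.≤-respʳ-≃ (ℚᵘ.≃-sym (toℚᵘ-·1 ℤ.∣ k ∣)) (ℚᵘ.*≤* k*1≤∣k∣*d))
  where
  k≤∣k∣ : ∀ k → k ℤ.≤ + ℤ.∣ k ∣
  k≤∣k∣ (+ n)      = ℤ.≤-refl
  k≤∣k∣ ℤ.-[1+ n ] = ℤ.-≤+

  k*1≤∣k∣*d : k ℤ.* + 1 ℤ.≤ + ℤ.∣ k ∣ ℤ.* + suc d
  k*1≤∣k∣*d = ℤ.≤-trans (ℤ.≤-reflexive (ℤ.*-identityʳ k)) (ℤ.≤-trans (k≤∣k∣ k)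
    (ℤ.≤-trans (ℤ.≤-reflexive (sym (ℤ.*-identityʳ (+ ℤ.∣ k ∣))))
      (ℤ.*-monoˡ-≤-nonNeg (+ ℤ.∣ k ∣) (ℤ.+≤+ (s≤s z≤n)))))

-- Antitone sequences and Chebyshev's sum inequality.

Antitone : ∀ {n} → (Fin n → ℚ) → Set
Antitone {n} y = ∀ (j k : Fin n) → toℕ k ≡ suc (toℕ j) → y k ≤ y j

antitone-tail : ∀ {n} {y : Fin (suc n) → ℚ} → Antitone y → Antitone (y ∘ Fin.suc)
antitone-tail anti j k eq = anti (Fin.suc j) (Fin.suc k) (cong suc eq)

-- Every term lies below the first. Bounding the entries at index 0, rather than naming a first
-- entry, lets the statement cover the empty sequence.
antitone-sum : ∀ {n} (y : Fin n → ℚ) {z} → Antitone y → (∀ k → toℕ k ≡ 0 → y k ≤ z) →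
               sum y ≤ n · 1ℚ * z
antitone-sum {zero}  y {z} anti y₀≤z = ≤-reflexive (sym (*-zeroˡ z))
antitone-sum {suc n} y {z} anti y₀≤z = begin
  y Fin.zero + sum (y ∘ Fin.suc)  ≤⟨ +-mono-≤ y0≤z
    (antitone-sum (y ∘ Fin.suc) (antitone-tail anti)
      λ k eq → ≤-trans (anti Fin.zero (Fin.suc k) (cong suc eq)) y0≤z) ⟩
  z + n · 1ℚ * z                  ≡⟨ solve 2 (λ z n → z :+ n :* z := (con 1ℚ :+ n) :* z) refl z (n · 1ℚ) ⟩
  (1ℚ + n · 1ℚ) * z               ∎
  where
  open ≤-Reasoning
  y0≤z = y₀≤z Fin.zero refl

-- The contribution of product 0 to the LP objective, with sales indexed from zero.
weighted : ∀ {n} → (Fin n → ℚ) → ℚ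
weighted y = sum (λ k → suc (toℕ k) · 2ℚ * y k)

-- Moving each tail entry one place further raises its weight by 2, hence the extra multiple of the
-- tail sum.
weighted-suc : ∀ {n} (y : Fin (suc n) → ℚ) →
  weighted y ≡ 2ℚ * y Fin.zero + (2ℚ * sum (y ∘ Fin.suc) + weighted (y ∘ Fin.suc))
weighted-suc {n} y = cong (_+_ (2ℚ * y Fin.zero)) (begin
  sum (λ k → (2ℚ + suc (toℕ k) · 2ℚ) * y′ k)
    ≡⟨ sum-cong-≗ (λ k → *-distribʳ-+ (y′ k) 2ℚ (suc (toℕ k) · 2ℚ)) ⟩
  sum (λ k → 2ℚ * y′ k + suc (toℕ k) · 2ℚ * y′ k)
    ≡⟨ ∑-distrib-+ (λ k → 2ℚ * y′ k) (λ k → suc (toℕ k) · 2ℚ * y′ k) ⟩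
  sum (λ k → 2ℚ * y′ k) + weighted y′
    ≡⟨ cong (_+ weighted y′) (*-distribˡ-sum 2ℚ y′) ⟨
  2ℚ * sum y′ + weighted y′ ∎)
  where
  open ≡-Reasoning
  y′ = y ∘ Fin.suc

-- The weights 2, 4, up to 2n average n + 1, and the larger weights fall on the smaller entries.
-- After the induction hypothesis, what remains is that the tail sum is at most its length times the
-- head.
chebyshev : ∀ {n} (y : Fin n → ℚ) → Antitone y → weighted y ≤ suc n · 1ℚ * sum y
chebyshev {zero}  y anti = ≤-refl
chebyshev {suc n} y anti = begin
  weighted y                                           ≡⟨ weighted-suc y ⟩
  2ℚ * y₀ + (2ℚ * S + weighted y′)                     ≤⟨ +-monoʳ-≤ (2ℚ * y₀) (+-monoʳ-≤ (2ℚ * S) (chebyshev y′ (antitone-tail anti))) ⟩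
  2ℚ * y₀ + (2ℚ * S + (1ℚ + N) * S)                    ≡⟨ solve 3 (λ y₀ S N →
    con 2ℚ :* y₀ :+ (con 2ℚ :* S :+ (con 1ℚ :+ N) :* S) :=
    S :+ (con 2ℚ :* y₀ :+ (con 2ℚ :+ N) :* S)) refl y₀ S N ⟩
  S + (2ℚ * y₀ + (2ℚ + N) * S)                         ≤⟨ +-monoˡ-≤ (2ℚ * y₀ + (2ℚ + N) * S)
    (antitone-sum y′ (antitone-tail anti) λ k eq → anti Fin.zero (Fin.suc k) (cong suc eq)) ⟩
  N * y₀ + (2ℚ * y₀ + (2ℚ + N) * S)                    ≡⟨ solve 3 (λ y₀ S N →
    N :* y₀ :+ (con 2ℚ :* y₀ :+ (con 2ℚ :+ N) :* S) :=
    (con 1ℚ :+ (con 1ℚ :+ N)) :* (y₀ :+ S)) refl y₀ S N ⟩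
  (1ℚ + (1ℚ + N)) * (y₀ + S)                           ∎
  where
  open ≤-Reasoning
  y₀ = y Fin.zero
  y′ = y ∘ Fin.suc
  S  = sum y′
  N  = n · 1ℚ

sum-const : ∀ n z → sum {n} (λ _ → z) ≡ n · 1ℚ * z
sum-const zero    z = sym (*-zeroˡ z)
sum-const (suc n) z = trans (cong (_+_ z) (sum-const n z))
  (solve 2 (λ z n → z :+ n :* z := (con 1ℚ :+ n) :* z) refl z (n · 1ℚ))

-- The equality case of `chebyshev`, which makes `spread` reach the LP bound.
weighted-const : ∀ n z → weighted {n} (λ _ → z) ≡ suc n · 1ℚ * sum {n} (λ _ → z)
weighted-const zero    z = refl
weighted-const (suc n) z = begin
  weighted {suc n} (λ _ → z)                  ≡⟨ weighted-suc {n} (λ _ → z) ⟩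
  2ℚ * z + (2ℚ * S + weighted {n} (λ _ → z))  ≡⟨ cong (λ w → 2ℚ * z + (2ℚ * S + w)) (weighted-const n z) ⟩
  2ℚ * z + (2ℚ * S + (1ℚ + N) * S)            ≡⟨ cong (λ S → 2ℚ * z + (2ℚ * S + (1ℚ + N) * S)) (sum-const n z) ⟩
  2ℚ * z + (2ℚ * (N * z) + (1ℚ + N) * (N * z)) ≡⟨ solve 2 (λ z N →
    con 2ℚ :* z :+ (con 2ℚ :* (N :* z) :+ (con 1ℚ :+ N) :* (N :* z)) :=
    (con 1ℚ :+ (con 1ℚ :+ N)) :* (z :+ N :* z)) refl z N ⟩
  (1ℚ + (1ℚ + N)) * (z + N * z)               ≡⟨ cong (λ S → (1ℚ + (1ℚ + N)) * (z + S)) (sum-const n z) ⟨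
  (1ℚ + (1ℚ + N)) * (z + S)                   ∎
  where
  open ≡-Reasoning
  S = sum {n} (λ _ → z)
  N = n · 1ℚ

-- The linear bonus and a bound on expectations.

0≤1 : 0ℚ ≤ 1ℚ
0≤1 = nonNegative⁻¹ 1ℚ

0≤2 : 0ℚ ≤ 2ℚ
0≤2 = nonNegative⁻¹ 2ℚ

-- Its increments are constant, so it is concave with equality whatever the capacity.
double : ℕ → ℚ
double k = k · 2ℚ

double-isBonus : IsBonus double
double-isBonus = record
  { nonnegative   = λ k → ·-nonNegative k 0≤2
  ; nondecreasing = ·-monoˡ-≤ 0≤2
  ; at-zero       = refl
  }

double-concave : ∀ b → DiscreteConcave b double
double-concave b k _ = ≤-reflexive (solve 1 (λ x →
  con 2ℚ :+ (con 2ℚ :+ x) :- (con 2ℚ :+ x) := con 2ℚ :+ x :- x) refl (k · 2ℚ))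

𝔼-bounded : ∀ {A} (d : Dist A) {X v} → IsProbability d → (∀ x → X x ≤ v) → 𝔼 d X ≤ v
𝔼-bounded d {X} {v} (w≥0 , total) X≤v = begin
  𝔼 d X              ≤⟨ bound d w≥0 ⟩
  totalWeight d * v  ≡⟨ cong (_* v) total ⟩
  1ℚ * v             ≡⟨ *-identityˡ v ⟩
  v                  ∎
  where
  open ≤-Reasoning
  bound : ∀ d → All (λ wx → 0ℚ ≤ proj₁ wx) d → 𝔼 d X ≤ totalWeight d * v
  bound []            []          = ≤-reflexive (sym (*-zeroˡ v))
  bound ((w , x) ∷ d) (0≤w ∷ w≥0) = begin
    w * X x + 𝔼 d X           ≤⟨ +-mono-≤ (*-monoˡ-≤-nonNeg w {{nonNegative 0≤w}} (X≤v x)) (bound d w≥0) ⟩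
    w * v + totalWeight d * v ≡⟨ *-distribʳ-+ v w (totalWeight d) ⟨
    (w + totalWeight d) * v   ∎

pattern 0F = Fin.zero
pattern 1F = Fin.suc Fin.zero

-- The family of instances.

module Example (n : ℕ) where

  I : Instance
  I = record
    { m         = 2
    ; capacity  = λ { 0F → suc (suc n) ; 1F → 1 }
    -- The bonus of a first sale adds 2, so the only sale of product 1 pays n + 2.
    ; reward    = λ { 0F → 0ℚ ; 1F → n · 1ℚ }
    ; reward≥0  = λ { 0F → ≤-refl ; 1F → ·-nonNegative n 0≤1 }
    ; bonus     = λ _ → double
    ; isBonus   = λ _ → double-isBonus
    ; T         = 1
    ; arrival   = λ _ → 1ℚ
    ; arrival≥0 = λ _ → 0≤1
    ; arrival≤1 = λ _ → ≤-refl
    }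

  open Model I hiding (IsOPTon; LPOptimal; 𝔼Rev; module Rounding)

  -- Revenue in the single period and the online optimum.

  N OPT : ℚ
  N   = n · 1ℚ
  OPT = N + 2ℚ

  -- The outcome without an arrival is still listed in the distribution, but with weight zero.
  𝔼-revenue : ∀ δ → 𝔼 arrivals (revenueFrom δ []) ≡ decisionReward [] (δ [])
  𝔼-revenue δ = solve 1 (λ r →
    con 1ℚ :* (r :+ con 0ℚ) :+ (con 0ℚ :* con 0ℚ :+ con 0ℚ) := r)
    refl (decisionReward [] (δ []))

  2≤OPT : 2ℚ ≤ OPT
  2≤OPT = +-monoˡ-≤ 2ℚ (·-nonNegative n 0≤1)

  decisionReward≤OPT : ∀ d → decisionReward [] d ≤ OPT
  decisionReward≤OPT (assign 0F) = 2≤OPT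
  decisionReward≤OPT (assign 1F) = ≤-refl
  decisionReward≤OPT reject      = ≤-trans 0≤2 2≤OPT

  serveProduct1 : Policy
  serveProduct1 = record
    { Seed     = ⊤
    ; seedDist = (1ℚ , tt) ∷ []
    -- Feasibility ranges over all histories, even those longer than the horizon; rejecting on
    -- nonempty ones never exceeds the capacity.
    ; decide   = λ { _ [] → assign 1F ; _ (_ ∷ _) → reject }
    }

  serveProduct1-online : IsOnline serveProduct1
  serveProduct1-online = record
    { probability = (0≤1 ∷ []) , refl
    ; feasible    = λ { _ [] 1F refl → s≤s z≤n }
    }

  𝔼Rev-serveProduct1 : 𝔼Rev I serveProduct1 ≡ OPT
  𝔼Rev-serveProduct1 = trans
    (cong (λ r → 1ℚ * r + 0ℚ) (𝔼-revenue (Policy.decide serveProduct1 tt)))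
    (trans (+-identityʳ (1ℚ * OPT)) (*-identityˡ OPT))

  -- The bound holds for each seed and therefore on average; `serveProduct1` attains it, so no
  -- smaller bound exists.
  isOPTon : IsOPTon I OPT
  isOPTon = record
    { upper = λ π on → 𝔼-bounded (Policy.seedDist π) (IsOnline.probability on) λ s →
        ≤-trans (≤-reflexive (𝔼-revenue (Policy.decide π s))) (decisionReward≤OPT (Policy.decide π s []))
    ; least = λ u bound → subst (_≤ u) 𝔼Rev-serveProduct1
        (bound serveProduct1 serveProduct1-online)
    }

  -- Upper bound on the LP value.

  A : ℚ
  A = suc (suc (suc n)) · 1ℚ

  used₀ used₁ : LPVar → ℚ
  used₀ y = sum (y 0F)
  used₁ y = y 1F 0F

  objective-split : ∀ y → objective y ≡ weighted (y 0F) + OPT * used₁ y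
  objective-split y = cong₂ _+_
    (sum-cong-≗ λ k → cong (_* y 0F k) (+-identityˡ (suc (toℕ k) · 2ℚ)))
    (trans (+-identityʳ _) (+-identityʳ _))

  budget-split : ∀ {y} → LPFeasible y → used₀ y + used₁ y ≤ 1ℚ
  budget-split {y} feas = subst (_≤ 1ℚ)
    (cong (_+_ (used₀ y)) (trans (+-identityʳ _) (+-identityʳ _))) (LPFeasible.budget feas)

  -- The average reward `A` = n + 3 of product 0 exceeds the reward of product 1 by exactly one.
  -- Adding `used₁ y` therefore gives both products the coefficient `A`, and the budget finishes.
  -- The surplus term later forces `used₁ y` to vanish at an optimum.
  objective-bound : ∀ {y} → LPFeasible y → objective y + used₁ y ≤ A
  objective-bound {y} feas = begin
    objective y + s                 ≡⟨ cong (_+ s) (objective-split y) ⟩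
    weighted (y 0F) + OPT * s + s   ≤⟨ +-monoˡ-≤ s (+-monoˡ-≤ (OPT * s) (chebyshev (y 0F) (LPFeasible.monotone feas 0F))) ⟩
    A * a + OPT * s + s             ≡⟨ solve 3 (λ N a s →
      (con 1ℚ :+ (con 1ℚ :+ (con 1ℚ :+ N))) :* a :+ (N :+ con 2ℚ) :* s :+ s :=
      (con 1ℚ :+ (con 1ℚ :+ (con 1ℚ :+ N))) :* (a :+ s)) refl N a s ⟩
    A * (a + s)                     ≤⟨ *-monoˡ-≤-nonNeg A {{nonNegative (·-nonNegative (3 ℕ.+ n) 0≤1)}} (budget-split feas) ⟩
    A * 1ℚ                          ≡⟨ *-identityʳ A ⟩
    A                               ∎
    where
    open ≤-Reasoning
    a = used₀ y
    s = used₁ y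

  -- The evenly spread LP solution and its optimality.

  B : ℚ
  B = suc (suc n) · 1ℚ

  1≤B : 1ℚ ≤ B
  1≤B = +-monoʳ-≤ 1ℚ (·-nonNegative (suc n) 0≤1)

  B-positive : Positive B
  B-positive = positive (<-≤-trans (positive⁻¹ 1ℚ) 1≤B)

  B-nonZero : NonZero B
  B-nonZero = pos⇒nonZero B {{B-positive}}

  -- The one expected arrival is shared equally among the n + 2 sales of product 0.
  z : ℚ
  z = (1/ B) {{B-nonZero}}

  0≤z : 0ℚ ≤ z
  0≤z = <⇒≤ (positive⁻¹ z {{1/pos⇒pos B {{B-positive}}}})

  z≤1 : z ≤ 1ℚ
  z≤1 = begin
    z       ≡⟨ *-identityˡ z ⟨
    1ℚ * z  ≤⟨ *-monoʳ-≤-nonNeg z {{nonNegative 0≤z}} 1≤B ⟩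
    B * z   ≡⟨ *-inverseʳ B {{B-nonZero}} ⟩
    1ℚ      ∎
    where open ≤-Reasoning

  spread : LPVar
  spread 0F _ = z
  spread 1F _ = 0ℚ

  used₀-spread : used₀ spread ≡ 1ℚ
  used₀-spread = trans (sum-const (suc (suc n)) z) (*-inverseʳ B {{B-nonZero}})

  spread-feasible : LPFeasible spread
  spread-feasible = record
    { budget   = ≤-reflexive (cong (_+ 0ℚ) used₀-spread)
    ; monotone = λ { 0F _ _ _ → ≤-refl ; 1F _ _ _ → ≤-refl }
    ; lower    = λ { 0F _ → 0≤z ; 1F _ → ≤-refl }
    ; upper    = λ { 0F _ → z≤1 ; 1F _ → 0≤1 }
    }

  objective-spread : objective spread ≡ A
  objective-spread = begin
    objective spread                     ≡⟨ objective-split spread ⟩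
    weighted (spread 0F) + OPT * 0ℚ      ≡⟨ cong₂ _+_ (weighted-const (suc (suc n)) z) (*-zeroʳ OPT) ⟩
    A * used₀ spread + 0ℚ                ≡⟨ +-identityʳ _ ⟩
    A * used₀ spread                     ≡⟨ cong (A *_) used₀-spread ⟩
    A * 1ℚ                               ≡⟨ *-identityʳ A ⟩
    A                                    ∎
    where open ≡-Reasoning

  spread-optimal : LPOptimal I spread
  spread-optimal = record
    { isFeasible = spread-feasible
    ; maximal    = λ y feas → begin
        objective y            ≡⟨ +-identityʳ _ ⟨
        objective y + 0ℚ       ≤⟨ +-monoʳ-≤ (objective y) (LPFeasible.lower feas 1F 0F) ⟩
        objective y + used₁ y  ≤⟨ objective-bound feas ⟩
        A                      ≡⟨ objective-spread ⟨
        objective spread       ∎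
    }
    where open ≤-Reasoning

  -- An optimal value is at least that of `spread`, namely `A`, which leaves no room for the surplus
  -- in `objective-bound`.
  optimal⇒used₁≡0 : ∀ {y} → LPOptimal I y → used₁ y ≡ 0ℚ
  optimal⇒used₁≡0 {y} opt = ≤-antisym s≤0 (LPFeasible.lower isFeasible 1F 0F)
    where
    open Model.LPOptimal opt
    open ≤-Reasoning
    s = used₁ y
    s≤0 : s ≤ 0ℚ
    s≤0 = begin
      s                                ≡⟨ solve 2 (λ s o → s := o :+ s :- o) refl s (objective y) ⟩
      objective y + s - objective y    ≤⟨ +-monoˡ-≤ (- objective y) (objective-bound isFeasible) ⟩
      A - objective y                  ≡⟨ cong (_- objective y) objective-spread ⟨
      objective spread - objective y   ≤⟨ +-monoˡ-≤ (- objective y) (maximal spread spread-feasible) ⟩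
      objective y - objective y        ≡⟨ +-inverseʳ (objective y) ⟩
      0ℚ                               ∎

  -- Revenue of the rounding policy.

  roundingPolicy : LPVar → Policy
  -- The mean number of arrivals evaluates to one, so the evidence that it is nonzero is found by
  -- eta.
  roundingPolicy y = Rounding.policy I y {{_}}

  𝔼Rev-rounding : ∀ y → 𝔼Rev I (roundingPolicy y) ≡ used₀ y * 2ℚ + used₁ y * OPT
  𝔼Rev-rounding y = begin
    𝔼Rev I (roundingPolicy y)
      -- The seed is one of three directions. Nothing has been sold yet, so `follow` carries out
      -- each of them unchanged.
      ≡⟨ cong₂ (λ r₁ r₂ → w * r₁ + r₂) (𝔼-revenue (decide (reject ∷ [])))
           (cong₂ (λ r₁ r₂ → w₀ * r₁ + (w₁ * r₂ + 0ℚ))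
             (𝔼-revenue (decide (assign 0F ∷ []))) (𝔼-revenue (decide (assign 1F ∷ [])))) ⟩
    w * 0ℚ + (w₀ * 2ℚ + (w₁ * OPT + 0ℚ))
      ≡⟨ drop-units w (q 0F) (q 1F) 2ℚ OPT ⟩
    q 0F * 2ℚ + q 1F * OPT
      ≡⟨ cong₂ (λ a s → a * 2ℚ + s * OPT) (*-identityˡ (used₀ y))
           (trans (*-identityˡ (sum (y 1F))) (+-identityʳ (used₁ y))) ⟩
    used₀ y * 2ℚ + used₁ y * OPT ∎
    where
    open ≡-Reasoning
    open Policy (roundingPolicy y) using (decide)
    open Rounding I y {{_}} using (q)
    -- The factor one is the weight of the empty tail in `independent`.
    w = (1ℚ - sum q) * 1ℚ
    w₀ = q 0F * 1ℚ
    w₁ = q 1F * 1ℚ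
    drop-units : ∀ w q₀ q₁ r₀ r₁ →
      w * 0ℚ + (q₀ * 1ℚ * r₀ + (q₁ * 1ℚ * r₁ + 0ℚ)) ≡ q₀ * r₀ + q₁ * r₁
    drop-units = solve 5 (λ w q₀ q₁ r₀ r₁ →
      w :* con 0ℚ :+ (q₀ :* con 1ℚ :* r₀ :+ (q₁ :* con 1ℚ :* r₁ :+ con 0ℚ)) :=
      q₀ :* r₀ :+ q₁ :* r₁) refl

  𝔼Rev-rounding≤2 : ∀ {y} → LPOptimal I y → 𝔼Rev I (roundingPolicy y) ≤ 2ℚ
  𝔼Rev-rounding≤2 {y} opt = begin
    𝔼Rev I (roundingPolicy y)     ≡⟨ 𝔼Rev-rounding y ⟩
    used₀ y * 2ℚ + used₁ y * OPT  ≡⟨ cong (λ s → used₀ y * 2ℚ + s * OPT) s≡0 ⟩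
    used₀ y * 2ℚ + 0ℚ * OPT       ≡⟨ solve 2 (λ a o → a :* con 2ℚ :+ con 0ℚ :* o := (a :+ con 0ℚ) :* con 2ℚ) refl (used₀ y) OPT ⟩
    -- The zero is turned back into `used₁ y` to match the budget constraint.
    (used₀ y + 0ℚ) * 2ℚ           ≡⟨ cong (λ s → (used₀ y + s) * 2ℚ) s≡0 ⟨
    (used₀ y + used₁ y) * 2ℚ      ≤⟨ *-monoʳ-≤-nonNeg 2ℚ (budget-split (Model.LPOptimal.isFeasible opt)) ⟩
    1ℚ * 2ℚ                       ≡⟨⟩
    2ℚ                            ∎
    where
    open ≤-Reasoning
    s≡0 = optimal⇒used₁≡0 opt

  𝔼Rev-rounding< : ∀ c → 2ℚ < c * OPT → ∀ y → LPOptimal I y →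
                   𝔼Rev I (roundingPolicy y) < c * OPT
  𝔼Rev-rounding< c 2<c*OPT y opt = ≤-<-trans (𝔼Rev-rounding≤2 {y} opt) 2<c*OPT

-- Choice of n for a given c, and the theorem.

∃-large-multiple : ∀ c → 0ℚ < c → ∃[ n ] 2ℚ < c * (n · 1ℚ + 2ℚ)
∃-large-multiple c 0<c = n , (begin-strict
  2ℚ                 ≡⟨ *-identityʳ 2ℚ ⟨
  2ℚ * 1ℚ            ≡⟨ cong (2ℚ *_) (*-inverseʳ c) ⟨
  2ℚ * (c * 1/ c)    ≡⟨ solve 3 (λ t c d → t :* (c :* d) := c :* (t :* d)) refl 2ℚ c (1/ c) ⟩
  c * (2ℚ * 1/ c)    ≤⟨ *-monoˡ-≤-nonNeg c {{pos⇒nonNeg c}} 2/c≤n ⟩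
  c * (n · 1ℚ)       ≡⟨ cong (c *_) (+-identityʳ (n · 1ℚ)) ⟨
  c * (n · 1ℚ + 0ℚ)  <⟨ *-monoʳ-<-pos c (+-monoʳ-< (n · 1ℚ) (positive⁻¹ 2ℚ)) ⟩
  c * (n · 1ℚ + 2ℚ)  ∎)
  where
  open ≤-Reasoning
  instance
    c-positive : Positive c
    c-positive = positive 0<c

    c-nonZero : NonZero c
    c-nonZero = pos⇒nonZero c

  -- Having n at least 2/c gives only the weak inequality; the additional 2 in the optimum makes it
  -- strict.
  n : ℕ
  n = proj₁ (archimedean (2ℚ * 1/ c))

  2/c≤n : 2ℚ * 1/ c ≤ n · 1ℚ
  2/c≤n = proj₂ (archimedean (2ℚ * 1/ c))

proposition5 : ∀ (c : ℚ) → 0ℚ < c →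
    ∃[ I ] ∃[ f ]
    IsBonus f ×
    (∀ i → DiscreteConcave (capacity I i) f) ×
    (∀ i k → bonus I i k ≡ f k) ×
    Σ (NonZero (meanArrivals I)) λ μ≢0 →
    ∃[ OPT ]
    IsOPTon I OPT ×
    (∃[ y ] LPOptimal I y) ×
    (∀ y → LPOptimal I y →
    𝔼Rev I (Rounding.policy I y {{μ≢0}}) < c * OPT)
proposition5 c 0<c =
  let n , 2<c*OPT = ∃-large-multiple c 0<c
      open Example n
  in
  I , double , double-isBonus , (λ i → double-concave (capacity I i)) , (λ _ _ → refl) ,
  -- Exhibiting `spread` ensures that the claim about all optimal LP solutions is not vacuous.
  _ , OPT , isOPTon , (spread , spread-optimal) , 𝔼Rev-rounding< c 2<c*OPT
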